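{- Let $\kappa<\lambda$ be regular uncountable cardinals and suppose there is a $\square(\lambda,<\kappa)$-sequence that is not full. Then $\mathrm{Refl}(2,\lambda)$ fails, i.e., there are two stationary subsets of $\lambda$ that do not reflect simultaneously.
   Context: For a set of ordinals $A$, $\mathrm{acc}(A)$ is the set of $\beta<\sup\{\alpha+1\mid\alpha\in A\}$ with $\beta=\sup(A\cap\beta)$. A coherent sequence of length $\lambda$ and width $<\eta$ is $\mathcal{C}=\langle\mathcal{C}_\alpha\mid\alpha<\lambda\rangle$ where each $\mathcal{C}_\alpha$ is a nonempty set of fewer than $\eta$ closed unbounded subsets of $\alpha$ (for successor $\alpha=\beta+1$, $\mathcal{C}_\alpha=\{\{\beta\}\}$), such that for all $\beta<\lambda$, $C\in\mathcal{C}_\beta$ and $\alpha\in\mathrm{acc}(C)$, $C\cap\alpha\in\mathcal{C}_\alpha$. A thread is a club $D\subseteq\lambda$ with $D\cap\alpha\in\mathcal{C}_\alpha$ for all $\alpha\in\mathrm{acc}(D)$. A $\square(\lambda,<\eta)$-sequence is a coherent sequence of length $\lambda$ and width $<\eta$ with no thread. For a coherent sequence $\mathcal{C}$, let $A_{\mathcal{C}}$ be the set of $\alpha<\lambda$ for which there is a club $D_\alpha\subseteq\lambda$ such that for every $\beta\in D_\alpha$, $\alpha\in\bigcup_{C\in\mathcal{C}_\beta}\mathrm{acc}(C)$; $\mathcal{C}$ is full if $A_{\mathcal{C}}$ is unbounded in $\lambda$. A stationary $S\subseteq\lambda$ reflects at $\alpha<\lambda$ if $\mathrm{cf}(\alpha)>\omega$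 and $S\cap\alpha$ is stationary in $\alpha$; two stationary sets reflect simultaneously if both reflect at a common $\alpha<\lambda$. -}

module Defs where

open import Level using (Level; suc; _⊔_)
open import Data.Product using (Σ; ∃; ∃-syntax; _×_; proj₁)
open import Function.Bundles using (Func; Bijection)
open import Induction.WellFounded using (WellFounded)
open import Relation.Binary.Bundles using (Setoid)
open import Relation.Binary.Core using (Rel)
open import Relation.Binary.Definitions using (_Respects_)
open import Relation.Binary.Structures using (IsStrictTotalOrder)
open import Relation.Binary.PropositionalEquality using (_≡_; setoid)
open import Relation.Nullary using (¬_)
open import Relation.Unary using (Pred; _∈_; _⊆_; _≐_; _∩_; _≬_; ｛_｝; Satisfiable)
open import Relation.Unary.Relation.Binary.Equality using (≐-setoid)
import Relation.Binary.Construct.On as On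
import Relation.Binary.Construct.StrictToNonStrict as StrictToNonStrict

-- An arbitrary well-ordered type whose elements serve as the ordinals. Every
-- ordinal λ occurs as an element of one (take λ + 1), and the notions below
-- that concern ordinals ≤ λ do not depend on what lies above λ.

record WellOrder (ℓ : Level) : Set (suc ℓ) where
  infix 4 _<_
  field
    Ord                : Set ℓ
    _<_                : Rel Ord ℓ
    isStrictTotalOrder : IsStrictTotalOrder _≡_ _<_
    <-wellFounded      : WellFounded _<_

module Ordinals {ℓ : Level} (O : WellOrder ℓ) where

  open WellOrder O public
  open StrictToNonStrict _≡_ _<_ public using (_≤_)

  private
    variable
      p : Level

  -- An ordinal as the set of its predecessors.
  ↓_ : Ord → Pred Ord ℓ
  (↓ α) ξ = ξ < α

  -- The same as a setoid; equality ignores the proof of ξ < α.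
  Seg : Ord → Setoid ℓ ℓ
  Seg α = On.setoid {B = Σ Ord (↓ α)} (setoid Ord) proj₁

  IsLeast : Pred Ord p → Pred Ord (ℓ ⊔ p)
  IsLeast P α = P α × (∀ β → P β → α ≤ β)

  IsSup : Pred Ord p → Pred Ord (ℓ ⊔ p)
  IsSup X = IsLeast (λ β → ∀ ξ → ξ ∈ X → ξ ≤ β)

  -- IsSucc β α says α = β + 1.
  IsSucc : Ord → Pred Ord ℓ
  IsSucc β = IsLeast (β <_)

  IsLimit : Pred Ord ℓ
  IsLimit α = Satisfiable (↓ α) × (∀ β → ¬ IsSucc β α)

  IsOmega : Pred Ord ℓ
  IsOmega = IsLeast IsLimit

  ω<_ : Pred Ord ℓ
  ω< α = ∃[ o ] IsOmega o × o < α

  CofinalMap : Ord → Ord → Set ℓ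
  CofinalMap α θ =
    Σ (Func (Seg θ) (Seg α)) λ f →
      ∀ β → β < α → ∃[ ξ ] β ≤ proj₁ (Func.to f ξ)

  -- IsCf α θ says cf(α) = θ; in particular cf(0) = 0 and cf(β + 1) = 1.
  IsCf : Ord → Pred Ord ℓ
  IsCf α = IsLeast (CofinalMap α)

  IsCardinal : Pred Ord ℓ
  IsCardinal κ = ∀ ν → ν < κ → ¬ Bijection (Seg ν) (Seg κ)

  record IsRegularUncountable (κ : Ord) : Set ℓ where
    field
      isCardinal  : IsCardinal κ
      regular     : IsCf κ κ
      uncountable : ω< κ

  Unbounded : Ord → Pred (Pred Ord p) (ℓ ⊔ p)
  Unbounded α X = ∀ β → β < α → ∃[ γ ] γ ∈ (X ∩ ↓ α) × β ≤ γ

  record IsClub (α : Ord) (C : Pred Ord ℓ) : Set ℓ where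
    field
      subset    : C ⊆ ↓ α
      closed    : ∀ β → β < α → IsLimit β → Unbounded β (C ∩ ↓ β) → β ∈ C
      unbounded : Unbounded α C

  IsStationary : Ord → Pred (Pred Ord ℓ) (suc ℓ)
  IsStationary α S = S ⊆ ↓ α × (∀ C → IsClub α C → S ≬ C)

  -- β < sup { α + 1 ∣ α ∈ A } and β = sup (A ∩ β). Since sup ∅ = 0, this puts
  -- 0 into acc A for every nonempty A.
  acc : Pred Ord ℓ → Pred Ord ℓ
  acc A β =
    (∃[ σ ] IsSup (λ γ → ∃[ α ] α ∈ A × IsSucc α γ) σ × β < σ)
    × IsSup (A ∩ ↓ β) β

  -- A family of subsets of Ord, as a setoid under extensional equality.
  Members : Pred (Pred Ord ℓ) ℓ → Setoid (suc ℓ) ℓ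
  Members 𝒳 = On.setoid {B = Σ (Pred Ord ℓ) 𝒳} (≐-setoid Ord ℓ) proj₁

  FewerThan : Ord → Pred (Pred (Pred Ord ℓ) ℓ) (suc ℓ)
  FewerThan η 𝒳 = ∃[ ν ] ν < η × Bijection (Members 𝒳) (Seg ν)

  -- Only the values at α < λ of a sequence of length λ are ever used.
  Sequence : Set (suc ℓ)
  Sequence = Ord → Pred (Pred Ord ℓ) ℓ

  record IsCoherent (Λ η : Ord) (𝒞 : Sequence) : Set (suc ℓ) where
    field
      -- Subsets are predicates, so a set of subsets must respect
      -- extensional equality.
      extensional : ∀ α → α < Λ → 𝒞 α Respects _≐_
      nonempty    : ∀ α → α < Λ → Satisfiable (𝒞 α)
      width       : ∀ α → α < Λ → FewerThan η (𝒞 α)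
      club        : ∀ α → α < Λ → ∀ C → C ∈ 𝒞 α → IsClub α C
      successor   : ∀ α → α < Λ → ∀ β → IsSucc β α → 𝒞 α ≐ (_≐ ｛ β ｝)
      coherent    : ∀ β → β < Λ → ∀ C → C ∈ 𝒞 β →
                    ∀ α → α ∈ acc C → (C ∩ ↓ α) ∈ 𝒞 α

  IsThread : Ord → Sequence → Pred (Pred Ord ℓ) ℓ
  IsThread Λ 𝒞 D = IsClub Λ D × (∀ α → α ∈ acc D → (D ∩ ↓ α) ∈ 𝒞 α)

  -- IsSquare Λ η 𝒞 says 𝒞 is a □(Λ,<η)-sequence.
  IsSquare : Ord → Ord → Pred Sequence (suc ℓ)
  IsSquare Λ η 𝒞 = IsCoherent Λ η 𝒞 × ¬ ∃ (IsThread Λ 𝒞)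

  -- The set A_𝒞.
  Stable : Ord → Sequence → Pred Ord (suc ℓ)
  Stable Λ 𝒞 α =
    α < Λ × (∃[ D ] IsClub Λ D × (∀ β → β ∈ D → ∃[ C ] C ∈ 𝒞 β × α ∈ acc C))

  IsFull : Ord → Pred Sequence (suc ℓ)
  IsFull Λ 𝒞 = Unbounded Λ (Stable Λ 𝒞)

  ReflectsAt : Pred Ord ℓ → Pred Ord (suc ℓ)
  ReflectsAt S α = (∃[ θ ] IsCf α θ × ω< θ) × IsStationary α (S ∩ ↓ α)

  ReflectSimultaneously : Ord → Pred Ord ℓ → Pred Ord ℓ → Set (suc ℓ)
  ReflectSimultaneously Λ S T =
    ∃[ α ] α < Λ × ReflectsAt S α × ReflectsAt T α

{-# OPTIONS --safe #-}

-- Fix a bound α₀ < λ of A_𝒞 and, for α < λ, let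
--   S α = { β < λ ∣ α ∉ acc C for every C ∈ 𝒞 β },
--   T α = { β < λ ∣ α ∈ acc C for every C ∈ 𝒞 β }.
-- S α and T α never reflect simultaneously: at a common reflection point γ
-- choose C ∈ 𝒞 γ; both sets meet the club acc C ∖ (α + 1) of γ, and by coherence
-- a point of S α there gives α ∉ acc C while a point of T α gives α ∈ acc C.
-- For α ≥ α₀, S α is stationary because α ∉ A_𝒞. If β has cofinality κ, the
-- intersection of acc C over the fewer than κ many C ∈ 𝒞 β is unbounded in β,
-- so β lies in T α for some α₀ ≤ α < β; as such β form a stationary set, some
-- T α with α ≥ α₀ is stationary by Fodor's argument.

module Submission where

open import Defs
open import Level using (Level; suc; _⊔_; Lift; lift; lower)
open import Axiom.ExcludedMiddle using (ExcludedMiddle)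
open import Data.Empty using (⊥-elim)
open import Data.Product using (∃; ∃-syntax; _×_; _,_; proj₁; proj₂)
open import Data.Sum using (inj₁; inj₂)
open import Function.Bundles using (Bijection)
open import Induction.WellFounded using (WfRec; module All; module FixPoint)
open import Relation.Binary.Definitions using (tri<; tri≈; tri>)
open import Relation.Binary.PropositionalEquality using (_≡_; refl; sym; trans; cong; subst)
open import Relation.Binary.Structures using (IsStrictTotalOrder)
open import Relation.Nullary using (¬_; yes; no)
open import Relation.Nullary.Decidable using (True; toWitness; fromWitness; decidable-stable; map′)
open import Relation.Unary using (Pred; _∈_; _≐_; _∩_; Satisfiable)

-- ExcludedMiddle decides untruncated Σ-types, so it also yields choice.
module Classical {ℓ : Level} (em : ExcludedMiddle (suc ℓ)) (O : WellOrder ℓ) where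

  open Ordinals O
  open IsStrictTotalOrder isStrictTotalOrder using (compare; irrefl) renaming (trans to <-trans)

  -- Classical logic and resizing

  em₀ : ExcludedMiddle ℓ
  em₀ {P} = map′ lower lift (em {Lift (suc ℓ) P})

  -- Stationarity concerns subsets at level `ℓ`, while quantifying over the members of `𝒞 β` lands
  -- one level up. Excluded middle replaces such a proposition by its truth value, which is small.
  Resize : Set (suc ℓ) → Set ℓ
  Resize P = Lift ℓ (True (em {P}))

  resize : ∀ {P} → P → Resize P
  resize p = lift (fromWitness p)

  unresize : ∀ {P} → Resize P → P
  unresize (lift p) = toWitness p

  -- Order

  <-irrefl : ∀ {α} → ¬ α < α
  <-irrefl = irrefl refl

  <-≤-trans : ∀ {α β γ} → α < β → β ≤ γ → α < γ
  <-≤-trans α<β (inj₁ β<γ) = <-trans α<β β<γ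
  <-≤-trans α<β (inj₂ refl) = α<β

  ≤-<-trans : ∀ {α β γ} → α ≤ β → β < γ → α < γ
  ≤-<-trans (inj₁ α<β) β<γ = <-trans α<β β<γ
  ≤-<-trans (inj₂ refl) β<γ = β<γ

  ≤⇒≯ : ∀ {α β} → α ≤ β → ¬ β < α
  ≤⇒≯ α≤β β<α = <-irrefl (≤-<-trans α≤β β<α)

  ≮⇒≥ : ∀ {α β} → ¬ α < β → β ≤ α
  ≮⇒≥ {α} {β} α≮β with compare α β
  ... | tri< α<β _ _ = ⊥-elim (α≮β α<β)
  ... | tri≈ _ α≡β _ = inj₂ (sym α≡β)
  ... | tri> _ _ β<α = inj₁ β<α

  ≰⇒> : ∀ {α β} → ¬ α ≤ β → β < α
  ≰⇒> α≰β = decidable-stable em₀ λ β≮α → α≰β (≮⇒≥ β≮α)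

  ≤-antisym : ∀ {α β} → α ≤ β → β ≤ α → α ≡ β
  ≤-antisym (inj₂ α≡β) _ = α≡β
  ≤-antisym (inj₁ α<β) β≤α = ⊥-elim (≤⇒≯ β≤α α<β)

  upper-bound : ∀ {μ α β} → α < μ → β < μ → ∃[ γ ] γ < μ × α ≤ γ × β ≤ γ
  upper-bound {α = α} {β} α<μ β<μ with em₀ {α < β}
  ... | yes α<β = β , β<μ , inj₁ α<β , inj₂ refl
  ... | no α≮β = α , α<μ , inj₂ refl , ≮⇒≥ α≮β

  least : ∀ {P : Pred Ord ℓ} → Satisfiable P → ∃ (IsLeast P)
  least {P} (α , Pα) = All.wfRec <-wellFounded ℓ (λ α → P α → ∃ (IsLeast P)) step α Pα
    where
    step : ∀ α → WfRec _<_ (λ α → P α → ∃ (IsLeast P)) α → P α → ∃ (IsLeast P)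
    step α rec Pα with em₀ {∃[ β ] β < α × P β}
    ... | yes (β , β<α , Pβ) = rec β<α Pβ
    ... | no none = α , Pα , λ β Pβ → ≮⇒≥ λ β<α → none (β , β<α , Pβ)

  -- The default is returned when P is empty.
  inf : Ord → Pred Ord ℓ → Ord
  inf default P with em₀ {Satisfiable P}
  ... | yes s = proj₁ (least s)
  ... | no _ = default

  inf-isLeast : ∀ {default P} → Satisfiable P → IsLeast P (inf default P)
  inf-isLeast {P = P} s with em₀ {Satisfiable P}
  ... | yes s′ = proj₂ (least s′)
  ... | no ¬s = ⊥-elim (¬s s)

  -- Least elements are unique, so the witness handed to `least` does not affect the value.
  -- Recursions defined through `inf` therefore unfold.
  inf-cong : ∀ {default P Q} → P ≐ Q → inf default P ≡ inf default Q
  inf-cong {P = P} {Q} (P⊆Q , Q⊆P) with em₀ {Satisfiable P} | em₀ {Satisfiable Q}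
  ... | no _ | no _ = refl
  ... | yes (α , Pα) | no ¬s = ⊥-elim (¬s (α , P⊆Q Pα))
  ... | no ¬s | yes (α , Qα) = ⊥-elim (¬s (α , Q⊆P Qα))
  ... | yes s | yes t with least s | least t
  ...   | α , Pα , α-least | β , Qβ , β-least =
    ≤-antisym (α-least β (Q⊆P Qβ)) (β-least α (P⊆Q Pα))

  NoMaximum : Ord → Set ℓ
  NoMaximum α = ∀ β → β < α → ∃[ γ ] γ < α × β < γ

  noMaximum⇒isLimit : ∀ {α} → Satisfiable (↓ α) → NoMaximum α → IsLimit α
  noMaximum⇒isLimit nonempty noMax = nonempty , λ β (β<α , α-least) →
    let γ , γ<α , β<γ = noMax β β<α in ≤⇒≯ (α-least γ β<γ) γ<α

  isLimit⇒noMaximum : ∀ {α} → IsLimit α → NoMaximum α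
  isLimit⇒noMaximum {α} (_ , ¬succ) β β<α = decidable-stable em₀ λ none →
    ¬succ β (β<α , λ γ β<γ → ≮⇒≥ λ γ<α → none (γ , γ<α , β<γ))

  -- Cofinality

  infix 4 _<cf_

  -- ν < cf μ, for limit μ.
  _<cf_ : Ord → Ord → Set ℓ
  ν <cf μ = (f : Ord → Ord) → (∀ ξ → ξ < ν → f ξ < μ) →
            ∃[ β ] β < μ × (∀ ξ → ξ < ν → f ξ < β)

  isCf⇒<cf : ∀ {μ θ ν} → IsCf μ θ → ν < θ → ν <cf μ
  isCf⇒<cf {ν = ν} (_ , θ-least) ν<θ f f<μ = decidable-stable em₀ λ unbounded →
    ≤⇒≯ (θ-least ν (map , λ β β<μ → decidable-stable em₀ λ none →
      unbounded (β , β<μ , λ ξ ξ<ν → ≰⇒> λ β≤fξ → none ((ξ , ξ<ν) , β≤fξ)))) ν<θ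
    where
    map = record { to = λ (ξ , ξ<ν) → f ξ , f<μ ξ ξ<ν ; cong = cong f }

  <cf-collect : ∀ {r ν μ} {R : Ord → Ord → Set r} → ν <cf μ →
                (∀ ξ → ξ < ν → ∃[ η ] η < μ × R ξ η) →
                ∃[ β ] β < μ × (∀ ξ → ξ < ν → ∃[ η ] η < β × R ξ η)
  <cf-collect {ν = ν} {μ} {R} ν<cfμ h =
    let β , β<μ , f<β = ν<cfμ f (λ ξ ξ<ν → proj₁ (f-spec ξ ξ<ν))
    in β , β<μ , λ ξ ξ<ν → f ξ , f<β ξ ξ<ν , proj₂ (f-spec ξ ξ<ν)
    where
    f : Ord → Ord
    f ξ with em₀ {ξ < ν}
    ... | yes ξ<ν = proj₁ (h ξ ξ<ν)
    ... | no _ = ξ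

    f-spec : ∀ ξ → ξ < ν → f ξ < μ × R ξ (f ξ)
    f-spec ξ ξ<ν with em₀ {ξ < ν}
    ... | yes p = proj₂ (h ξ p)
    ... | no ¬p = ⊥-elim (¬p ξ<ν)

  -- A function on `ν` extends to `θ` by a constant `α` below `μ`; a bound for the extension bounds
  -- the function.
  <cf-downward : ∀ {ν θ μ} → Satisfiable (↓ μ) → ν < θ → θ <cf μ → ν <cf μ
  <cf-downward {ν} {μ = μ} (α , α<μ) ν<θ θ<cfμ f f<μ =
    let β , β<μ , below = <cf-collect θ<cfμ value
    in β , β<μ , λ ξ ξ<ν → let η , η<β , eq = below ξ (<-trans ξ<ν ν<θ)
                           in subst (_< β) (eq ξ<ν) η<β
    where
    value : ∀ ξ → _ → ∃[ η ] η < μ × (ξ < ν → η ≡ f ξ)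
    value ξ _ with em₀ {ξ < ν}
    ... | yes ξ<ν = f ξ , f<μ ξ ξ<ν , λ _ → refl
    ... | no ξ≮ν = α , α<μ , λ ξ<ν → ⊥-elim (ξ≮ν ξ<ν)

  <cf⇒noMaximum : ∀ {ν μ} → Satisfiable (↓ ν) → ν <cf μ → NoMaximum μ
  <cf⇒noMaximum (ξ , ξ<ν) ν<cfμ β β<μ =
    let γ , γ<μ , β<γ = ν<cfμ (λ _ → β) (λ _ _ → β<μ) in γ , γ<μ , β<γ ξ ξ<ν

  -- Transfinite iteration and closure points

  module Iteration {θ μ α₀ : Ord} (θ<cfμ : θ <cf μ) (α₀<μ : α₀ < μ)
                   (g : Ord → Ord) (g<μ : ∀ ξ → ξ < μ → g ξ < μ) where

    Above : ∀ i → WfRec _<_ (λ _ → Ord) i → Pred Ord ℓ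
    Above i x y = α₀ ≤ y × (∀ {j} (j<i : j < i) → x j<i < y × g (x j<i) < y)

    step : ∀ i → WfRec _<_ (λ _ → Ord) i → Ord
    step i x = inf α₀ (Above i x)

    step-cong : ∀ i {x x′ : WfRec _<_ (λ _ → Ord) i} →
                (∀ {j} (j<i : j < i) → x j<i ≡ x′ j<i) → step i x ≡ step i x′
    step-cong i {x} {x′} x≡x′ = inf-cong
      ( (λ {y} (α₀≤y , above) → α₀≤y , λ j<i → subst (λ z → z < y × g z < y) (x≡x′ j<i) (above j<i))
      , (λ {y} (α₀≤y , above) → α₀≤y , λ j<i → subst (λ z → z < y × g z < y) (sym (x≡x′ j<i)) (above j<i)))

    seq : Ord → Ord
    seq = All.wfRec <-wellFounded ℓ (λ _ → Ord) step

    seq-unfold : ∀ i → seq i ≡ step i (λ {j} _ → seq j)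
    seq-unfold i = FixPoint.unfold-wfRec <-wellFounded (λ _ → Ord) step step-cong

    seq-isLeast : ∀ i → Satisfiable (Above i (λ {j} _ → seq j)) →
                  IsLeast (Above i (λ {j} _ → seq j)) (seq i)
    seq-isLeast i s = subst (IsLeast _) (sym (seq-unfold i)) (inf-isLeast s)

    -- Since `i <cf μ`, the earlier terms and their `g`-values are each bounded below `μ`. So the
    -- infimum defining `seq i` is a genuine minimum and not the default.
    above : ∀ i → i < θ → (∀ j → j < i → seq j < μ) →
            ∃[ y ] y < μ × y ∈ Above i (λ {j} _ → seq j)
    above i i<θ seq<μ =
      let i<cfμ = <cf-downward (α₀ , α₀<μ) i<θ θ<cfμ
          β , β<μ , seq<β = i<cfμ seq seq<μ
          γ , γ<μ , gseq<γ = i<cfμ (λ j → g (seq j)) (λ j j<i → g<μ (seq j) (seq<μ j j<i))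
          δ , δ<μ , β≤δ , γ≤δ = upper-bound β<μ γ<μ
          y , y<μ , δ≤y , α₀≤y = upper-bound δ<μ α₀<μ
      in y , y<μ , α₀≤y , λ {j} j<i →
           <-≤-trans (<-≤-trans (seq<β j j<i) β≤δ) δ≤y ,
           <-≤-trans (<-≤-trans (gseq<γ j j<i) γ≤δ) δ≤y

    seq<μ : ∀ i → i < θ → seq i < μ
    seq<μ = All.wfRec <-wellFounded ℓ (λ i → i < θ → seq i < μ) λ i rec i<θ →
      let y , y<μ , y-above = above i i<θ (λ j j<i → rec j<i (<-trans j<i i<θ))
      in ≤-<-trans (proj₂ (seq-isLeast i (y , y-above)) y y-above) y<μ

    seq-above : ∀ i → i < θ → seq i ∈ Above i (λ {j} _ → seq j)
    seq-above i i<θ =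
      let y , _ , y-above = above i i<θ (λ j j<i → seq<μ j (<-trans j<i i<θ))
      in proj₁ (seq-isLeast i (y , y-above))

  -- `<cf-inherit` expresses cf(β) ≥ cf(θ) without naming either cofinality. `close` asks for
  -- witnesses only at cofinally many `ξ`, namely the terms of the sequence.
  record IsClosurePoint {q} (Q : Ord → Ord → Set q) (θ μ α₀ β : Ord) : Set (ℓ ⊔ q) where
    field
      below       : β < μ
      above       : α₀ < β
      isLimit     : IsLimit β
      <cf-inherit : ∀ ν → ν <cf θ → ν <cf β
      close       : ∀ γ → γ < β → ∃[ ξ ] γ < ξ × ξ < β × ∃[ η ] η < β × Q ξ η

  -- The point found is the supremum of an increasing sequence of length θ, each
  -- of whose terms bounds Q-witnesses for the preceding ones.
  closure-point : ∀ {q θ μ α₀} (Q : Ord → Ord → Set q) → IsLimit θ → θ <cf μ → α₀ < μ →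
                  (∀ ξ → ξ < μ → ∃[ η ] η < μ × Q ξ η) → ∃ (IsClosurePoint Q θ μ α₀)
  closure-point {θ = θ} {μ} {α₀} Q θ-limit@((i₀ , i₀<θ) , _) θ<cfμ α₀<μ h = β , record
    { below = β<μ
    ; above = α₀<β
    ; isLimit = noMaximum⇒isLimit (α₀ , α₀<β)
        (λ γ γ<β → let ξ , γ<ξ , ξ<β , _ = close γ γ<β in ξ , ξ<β , γ<ξ)
    ; <cf-inherit = <cf-inherit
    ; close = close
    }
    where
    g : Ord → Ord
    g ξ with em₀ {ξ < μ}
    ... | yes ξ<μ = proj₁ (h ξ ξ<μ)
    ... | no _ = ξ

    g-spec : ∀ ξ → ξ < μ → g ξ < μ × Q ξ (g ξ)
    g-spec ξ ξ<μ with em₀ {ξ < μ}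
    ... | yes p = proj₂ (h ξ p)
    ... | no ¬p = ⊥-elim (¬p ξ<μ)

    open Iteration {θ} θ<cfμ α₀<μ g (λ ξ ξ<μ → proj₁ (g-spec ξ ξ<μ))

    bound = θ<cfμ seq seq<μ
    -- The bound is strict, but `θ` is a limit and the terms increase strictly, so this is their
    -- supremum.
    sup = least {λ y → ∀ i → i < θ → seq i < y} (proj₁ bound , proj₂ (proj₂ bound))
    β = proj₁ sup

    seq<β : ∀ i → i < θ → seq i < β
    seq<β = proj₁ (proj₂ sup)

    β<μ : β < μ
    β<μ = ≤-<-trans (proj₂ (proj₂ sup) (proj₁ bound) (proj₂ (proj₂ bound))) (proj₁ (proj₂ bound))

    α₀<β : α₀ < β
    α₀<β = ≤-<-trans (proj₁ (seq-above i₀ i₀<θ)) (seq<β i₀ i₀<θ)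

    next : ∀ i → i < θ → ∃[ j ] j < θ × seq i < seq j × g (seq i) < seq j
    next i i<θ = let j , j<θ , i<j = isLimit⇒noMaximum θ-limit i i<θ
                 in j , j<θ , proj₂ (seq-above j j<θ) i<j

    cofinal : ∀ γ → γ < β → ∃[ i ] i < θ × γ < seq i
    cofinal γ γ<β =
      let i , i<θ , γ≤i = decidable-stable (em₀ {∃[ i ] i < θ × γ ≤ seq i}) λ none →
            ≤⇒≯ (proj₂ (proj₂ sup) γ λ i i<θ → ≰⇒> λ γ≤i → none (i , i<θ , γ≤i)) γ<β
          j , j<θ , i<j , _ = next i i<θ
      in j , j<θ , ≤-<-trans γ≤i i<j

    -- Each value of `f` lies below some term; the indices of these terms are bounded by some
    -- `i < θ`, and then `seq i` bounds `f`.
    <cf-inherit : ∀ ν → ν <cf θ → ν <cf β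
    <cf-inherit ν ν<cfθ f f<β =
      let i , i<θ , below = <cf-collect ν<cfθ (λ ξ ξ<ν → cofinal (f ξ) (f<β ξ ξ<ν))
      in seq i , seq<β i i<θ , λ ξ ξ<ν →
           let j , j<i , fξ<j = below ξ ξ<ν
           in <-trans fξ<j (proj₁ (proj₂ (seq-above i i<θ) j<i))

    close : ∀ γ → γ < β → ∃[ ξ ] γ < ξ × ξ < β × ∃[ η ] η < β × Q ξ η
    close γ γ<β =
      let i , i<θ , γ<i = cofinal γ γ<β
          j , j<θ , _ , gi<j = next i i<θ
      in seq i , γ<i , seq<β i i<θ , g (seq i) , <-trans gi<j (seq<β j j<θ) ,
         proj₂ (g-spec (seq i) (seq<μ i i<θ))

  -- Clubs and accumulation points

  Accumulates : Pred Ord ℓ → Ord → Set ℓ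
  Accumulates X α = IsSup (X ∩ ↓ α) α

  cofinal⇒accumulates : ∀ {X α} → (∀ γ → γ < α → ∃[ ξ ] ξ ∈ X × ξ < α × γ < ξ) → Accumulates X α
  cofinal⇒accumulates cofinal = (λ ξ (_ , ξ<α) → inj₁ ξ<α) , λ β β-bound →
    ≮⇒≥ λ β<α → let ξ , ξ∈X , ξ<α , β<ξ = cofinal β β<α in ≤⇒≯ (β-bound ξ (ξ∈X , ξ<α)) β<ξ

  accumulates⇒cofinal : ∀ {X α} → Accumulates X α → ∀ γ → γ < α → ∃[ ξ ] ξ ∈ X × ξ < α × γ < ξ
  accumulates⇒cofinal {X} {α} (_ , α-least) γ γ<α = decidable-stable em₀ λ none →
    ≤⇒≯ (α-least γ λ ξ (ξ∈X , ξ<α) → ≮⇒≥ λ γ<ξ → none (ξ , ξ∈X , ξ<α , γ<ξ)) γ<α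

  -- The supremum of the successors of elements of `X` is `μ` itself.
  accumulates⇒acc : ∀ {X μ α} → NoMaximum μ → Unbounded μ X → (∀ {ξ} → ξ ∈ X → ξ < μ) →
                    α < μ → Accumulates X α → α ∈ acc X
  accumulates⇒acc {X} {μ} noMax unbounded X<μ α<μ α-acc =
    (μ , ((λ γ (ξ , ξ∈X , _ , γ-least) → γ-least μ (X<μ ξ∈X)) , least-bound) , α<μ) , α-acc
    where
    least-bound : ∀ β → (∀ γ → ∃[ ξ ] ξ ∈ X × IsSucc ξ γ → γ ≤ β) → μ ≤ β
    least-bound β β-bound = ≮⇒≥ λ β<μ →
      let ξ , (ξ∈X , ξ<μ) , β≤ξ = unbounded β β<μ
          γ , γ-succ = least {ξ <_} (μ , ξ<μ)
      in ≤⇒≯ (β-bound γ (ξ , ξ∈X , γ-succ)) (≤-<-trans β≤ξ (proj₁ γ-succ))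

  accumulates-∩↓ : ∀ {X α β} → α < β → Accumulates X α → Accumulates (X ∩ ↓ β) α
  accumulates-∩↓ α<β α-acc = cofinal⇒accumulates λ γ γ<α →
    let ξ , ξ∈X , ξ<α , γ<ξ = accumulates⇒cofinal α-acc γ γ<α
    in ξ , (ξ∈X , <-trans ξ<α α<β) , ξ<α , γ<ξ

  accumulates-∩↓⁻ : ∀ {X α β} → Accumulates (X ∩ ↓ β) α → Accumulates X α
  accumulates-∩↓⁻ α-acc = cofinal⇒accumulates λ γ γ<α →
    let ξ , (ξ∈X , _) , ξ<α , γ<ξ = accumulates⇒cofinal α-acc γ γ<α in ξ , ξ∈X , ξ<α , γ<ξ

  -- Carries an accumulation point of `X` down to an initial segment, the kind of set that coherence
  -- puts into `𝒞 β`.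
  accumulates-acc-∩↓ : ∀ {X α β} → α < β → Accumulates X β → Accumulates X α → α ∈ acc (X ∩ ↓ β)
  accumulates-acc-∩↓ α<β β-acc α-acc = accumulates⇒acc
    (λ γ γ<β → let ξ , _ , ξ<β , γ<ξ = cofinal γ γ<β in ξ , ξ<β , γ<ξ)
    (λ γ γ<β → let ξ , ξ∈X , ξ<β , γ<ξ = cofinal γ γ<β in ξ , ((ξ∈X , ξ<β) , ξ<β) , inj₁ γ<ξ)
    proj₂ α<β (accumulates-∩↓ α<β α-acc)
    where cofinal = accumulates⇒cofinal β-acc

  -- Iterate "a later element of `X`" along `ω`; `ω <cf γ` keeps the limit of the iteration below
  -- `γ`.
  accumulation-point-above : ∀ {ω γ X ε} → IsLimit ω → ω <cf γ → Unbounded γ X → ε < γ →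
                             ∃[ β ] β < γ × ε < β × Accumulates X β
  accumulation-point-above {γ = γ} {X} {ε} ω-limit ω<cfγ unbounded ε<γ =
    accumulates (closure-point (λ ξ η → η ∈ X × ξ < η) ω-limit ω<cfγ ε<γ λ ξ ξ<γ →
      let ζ , ζ<γ , ξ<ζ = <cf⇒noMaximum (proj₁ ω-limit) ω<cfγ ξ ξ<γ
          η , (η∈X , η<γ) , ζ≤η = unbounded ζ ζ<γ
      in η , η<γ , η∈X , <-≤-trans ξ<ζ ζ≤η)
    where
    accumulates : ∀ {θ} → ∃ (IsClosurePoint (λ ξ η → η ∈ X × ξ < η) θ γ ε) →
                  ∃[ β ] β < γ × ε < β × Accumulates X β
    accumulates (β , point) = β , below , above , cofinal⇒accumulates λ ζ ζ<β →
      let ξ , ζ<ξ , _ , η , η<β , η∈X , ξ<η = close ζ ζ<β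
      in η , η∈X , η<β , <-trans ζ<ξ ξ<η
      where open IsClosurePoint point

  accumulation-club : ∀ {ω γ X α} → IsLimit ω → ω <cf γ → Unbounded γ X → α < γ →
                      IsClub γ (λ β → β < γ × α < β × Accumulates X β)
  accumulation-club {γ = γ} {X} {α} ω-limit ω<cfγ unbounded α<γ = record
    { subset = proj₁
    ; closed = λ β β<γ β-limit β-unbounded →
        β<γ , closed-α β β-limit β-unbounded , closed-acc β β-limit β-unbounded
    ; unbounded = λ δ δ<γ → 
        let ε , ε<γ , α≤ε , δ≤ε = upper-bound α<γ δ<γ
        in unbounded-above α≤ε δ≤ε (accumulation-point-above ω-limit ω<cfγ unbounded ε<γ)
    }
    where
    A : Pred Ord ℓ
    A β = β < γ × α < β × Accumulates X β

    unbounded-above : ∀ {δ ε} → α ≤ ε → δ ≤ ε → ∃[ β ] β < γ × ε < β × Accumulates X β →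
                      ∃[ β ] β ∈ (A ∩ ↓ γ) × δ ≤ β
    unbounded-above α≤ε δ≤ε (β , β<γ , ε<β , β-acc) =
      β , ((β<γ , ≤-<-trans α≤ε ε<β , β-acc) , β<γ) , inj₁ (≤-<-trans δ≤ε ε<β)

    closed-α : ∀ β → IsLimit β → Unbounded β (A ∩ ↓ β) → α < β
    closed-α β ((δ , δ<β) , _) β-unbounded =
      let ε , (((_ , α<ε , _) , _) , ε<β) , _ = β-unbounded δ δ<β in <-trans α<ε ε<β

    closed-acc : ∀ β → IsLimit β → Unbounded β (A ∩ ↓ β) → Accumulates X β
    closed-acc β β-limit β-unbounded = cofinal⇒accumulates λ δ δ<β →
      -- Unboundedness gives only a weak inequality, so `ζ` is interposed to make `ε` exceed `δ`
      -- strictly.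
      let ζ , ζ<β , δ<ζ = isLimit⇒noMaximum β-limit δ δ<β
          ε , (((_ , _ , ε-acc) , _) , ε<β) , ζ≤ε = β-unbounded ζ ζ<β
          ξ , ξ∈X , ξ<ε , δ<ξ = accumulates⇒cofinal ε-acc δ (<-≤-trans δ<ζ ζ≤ε)
      in ξ , ξ∈X , <-trans ξ<ε ε<β , δ<ξ

  ↓-club : ∀ α → IsClub α (↓ α)
  ↓-club α = record
    { subset = λ β<α → β<α
    ; closed = λ β β<α _ _ → β<α
    ; unbounded = λ β β<α → β , (β<α , β<α) , inj₂ refl
    }

  disjoint-club : ∀ {Λ S} → (∀ {β} → β ∈ S → β < Λ) → ¬ IsStationary Λ S →
                  ∃[ D ] IsClub Λ D × (∀ β → β ∈ S → ¬ β ∈ D)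
  disjoint-club {Λ} {S} S<Λ ¬stationary = decidable-stable em λ none →
    ¬stationary (S<Λ , λ C C-club → decidable-stable em₀ λ disjoint →
      none (C , C-club , λ β β∈S β∈C → disjoint (β , β∈S , β∈C)))

  stable-bound : ∀ {Λ 𝒞} → ¬ IsFull Λ 𝒞 → ∃[ α₀ ] α₀ < Λ × (∀ α → α₀ ≤ α → ¬ Stable Λ 𝒞 α)
  stable-bound ¬full = decidable-stable em λ none → ¬full λ β β<Λ →
    decidable-stable em λ none-above → none (β , β<Λ , λ α β≤α stable →
      none-above (α , (stable , proj₁ stable) , β≤α))

  -- The sets S α and T α of a coherent sequence

  module _ {κ Λ : Ord} {𝒞 : Sequence} (coh : IsCoherent Λ κ 𝒞) where

    open IsCoherent coh

    Avoiding : Ord → Pred Ord ℓ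
    Avoiding α β = β < Λ × Resize (¬ (∃[ C ] C ∈ 𝒞 β × α ∈ acc C))

    Hitting : Ord → Pred Ord ℓ
    Hitting α β = β < Λ × Resize (∀ C → C ∈ 𝒞 β → α ∈ acc C)

    -- A club disjoint from `Avoiding α` is exactly a club witnessing that `α` is stable.
    avoiding-stationary : ∀ {α} → α < Λ → ¬ Stable Λ 𝒞 α → IsStationary Λ (Avoiding α)
    avoiding-stationary α<Λ unstable = proj₁ , λ D D-club → decidable-stable em₀ λ disjoint →
      unstable (α<Λ , D , D-club , λ β β∈D → decidable-stable em λ none →
        disjoint (β , (IsClub.subset D-club β∈D , resize none) , β∈D))

    not-simultaneous : ∀ {α} → ¬ ReflectSimultaneously Λ (Avoiding α) (Hitting α)
    not-simultaneous {α} (γ , γ<Λ , ((θ , γ-cf , ω , ω-omega , ω<θ) , (_ , meets-S)) , (_ , (_ , meets-T)))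
      with em₀ {α < γ}
    ... | no α≮γ =
      -- Any `β < γ` in `Hitting α` has `α < β`, since the members of `𝒞 β` are subsets of `β`.
      let β , ((β<Λ , hits) , β<γ) , _ = meets-T (↓ γ) (↓-club γ)
          C , C∈𝒞β = nonempty β β<Λ
          (σ , (_ , σ-least) , α<σ) , _ = unresize hits C C∈𝒞β
          σ≤β = σ-least β λ δ (ξ , ξ∈C , _ , δ-least) →
            δ-least β (IsClub.subset (club β β<Λ C C∈𝒞β) ξ∈C)
      in α≮γ (<-trans (<-≤-trans α<σ σ≤β) β<γ)
    ... | yes α<γ =
      let C , C∈𝒞γ = nonempty γ γ<Λ
          C-club = club γ γ<Λ C C∈𝒞γ
          ω<cfγ = isCf⇒<cf γ-cf ω<θ
          γ-noMax = <cf⇒noMaximum (proj₁ (proj₁ ω-omega)) ω<cfγ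
          acc-club = accumulation-club (proj₁ ω-omega) ω<cfγ (IsClub.unbounded C-club) α<γ
          restrict : ∀ β → β < γ → Accumulates C β → (C ∩ ↓ β) ∈ 𝒞 β
          restrict β β<γ β-acc = coherent γ γ<Λ C C∈𝒞γ β
            (accumulates⇒acc γ-noMax (IsClub.unbounded C-club) (IsClub.subset C-club) β<γ β-acc)
          β , ((_ , avoids) , _) , (β<γ , α<β , β-acc) = meets-S _ acc-club
          δ , ((_ , hits) , _) , (δ<γ , α<δ , δ-acc) = meets-T _ acc-club
          -- The transfer from `δ` to `β` passes through the single club `C`, so the order of `β`
          -- and `δ` is irrelevant.
          (_ , α-acc) = unresize hits _ (restrict δ δ<γ δ-acc)
      in unresize avoids (_ , restrict β β<γ β-acc ,
           accumulates-acc-∩↓ α<β β-acc (accumulates-∩↓⁻ α-acc))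

    -- Each of `ω` many stages passes an element of every club in `𝒞 β`, so all of them accumulate
    -- at the limit. The `ν < κ` many clubs and the `ω` stages are both too few to be cofinal in
    -- `β`.
    common-accumulation-point : ∀ {α₀ β} → ω< κ → (∀ ν → ν < κ → ν <cf β) → β < Λ → α₀ < β →
                                ∃[ α ] α₀ < α × α < β × (∀ C → C ∈ 𝒞 β → α ∈ acc C)
    common-accumulation-point {α₀} {β} (ω , (ω-limit , _) , ω<κ) <κ⇒<cfβ β<Λ α₀<β =
      accumulates (closure-point Q ω-limit (<κ⇒<cfβ ω ω<κ) α₀<β λ ξ ξ<β →
        <cf-collect (<κ⇒<cfβ ν ν<κ) λ j j<ν → indexed-unbounded j j<ν ξ ξ<β)
      where
      ν = proj₁ (width β β<Λ)
      ν<κ = proj₁ (proj₂ (width β β<Λ))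
      open Bijection (proj₂ (proj₂ (width β β<Λ))) using (to; injective; strictlySurjective)

      -- Quantifying over every `C` of index `j` avoids choosing one; by injectivity they all have
      -- the same elements.
      Indexed : Ord → Pred Ord (suc ℓ)
      Indexed j ζ = ∀ C (C∈𝒞β : C ∈ 𝒞 β) → proj₁ (to (C , C∈𝒞β)) ≡ j → ζ ∈ C

      indexed-unbounded : ∀ j → j < ν → ∀ ξ → ξ < β → ∃[ ζ ] ζ < β × ζ ∈ Indexed j × ξ ≤ ζ
      indexed-unbounded j j<ν ξ ξ<β =
        let (C , C∈𝒞β) , toC≡j = strictlySurjective (j , j<ν)
            ζ , (ζ∈C , ζ<β) , ξ≤ζ = IsClub.unbounded (club β β<Λ C C∈𝒞β) ξ ξ<β
        in ζ , ζ<β ,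
           (λ C′ C′∈𝒞β toC′≡j →
             proj₁ (injective {C , C∈𝒞β} {C′ , C′∈𝒞β} (trans toC≡j (sym toC′≡j))) ζ∈C) ,
           ξ≤ζ

      Q : Ord → Ord → Set (suc ℓ)
      Q ξ η = ∀ j → j < ν → ∃[ ζ ] ζ < η × ζ ∈ Indexed j × ξ ≤ ζ

      accumulates : ∃ (IsClosurePoint Q ω β α₀) →
                    ∃[ α ] α₀ < α × α < β × (∀ C → C ∈ 𝒞 β → α ∈ acc C)
      accumulates (α , point) = α , above , below , λ C C∈𝒞β →
        let C-club = club β β<Λ C C∈𝒞β
            j , j<ν = to (C , C∈𝒞β)
        in accumulates⇒acc (<cf⇒noMaximum (proj₁ ω-limit) (<κ⇒<cfβ ω ω<κ))
             (IsClub.unbounded C-club) (IsClub.subset C-club) below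
             (cofinal⇒accumulates λ γ γ<α →
               let ξ , γ<ξ , ξ<α , η , η<α , witness = close γ γ<α
                   ζ , ζ<η , ζ∈ , ξ≤ζ = witness j j<ν
               in ζ , ζ∈ C C∈𝒞β refl , <-trans ζ<η η<α , <-≤-trans γ<ξ ξ≤ζ)
        where open IsClosurePoint point

    -- The proof of Fodor's lemma, run directly on a point β of cofinality κ in
    -- the diagonal intersection of the clubs D α.
    hitting-stationary : κ < Λ → IsRegularUncountable κ → IsRegularUncountable Λ → ∀ {α₀} → α₀ < Λ →
                         ∃[ α ] α₀ ≤ α × α < Λ × IsStationary Λ (Hitting α)
    hitting-stationary κ<Λ κ-regular Λ-regular {α₀} α₀<Λ = decidable-stable em absurd
      where
      module κ = IsRegularUncountable κ-regular
      module Λ = IsRegularUncountable Λ-regular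

      absurd : ¬ ¬ (∃[ α ] α₀ ≤ α × α < Λ × IsStationary Λ (Hitting α))
      absurd none =
        -- Iterating `κ` times makes every `ν < κ` satisfy `ν <cf β`. Regularity of `Λ` bounds both
        -- the `κ` stages and the `ξ` many clubs treated at `ξ`.
        let β , β-point = closure-point Q κ-limit (isCf⇒<cf Λ.regular κ<Λ) α₀<Λ λ ξ ξ<Λ →
              <cf-collect (isCf⇒<cf Λ.regular ξ<Λ) λ α _ →
                let ζ , (ζ∈D , ζ<Λ) , ξ≤ζ = IsClub.unbounded (D-club α) ξ ξ<Λ
                in ζ , ζ<Λ , ζ∈D , ξ≤ζ
            open IsClosurePoint β-point
        in contradict β-point (common-accumulation-point κ.uncountable
             (λ ν ν<κ → <cf-inherit ν (isCf⇒<cf κ.regular ν<κ)) below above)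
        where
        D-spec : ∀ α → ∃[ D ] IsClub Λ D × (α₀ ≤ α → α < Λ → ∀ β → β ∈ Hitting α → ¬ β ∈ D)
        D-spec α with em₀ {α₀ ≤ α × α < Λ}
        -- The trivial club serves as default, making `D` total.
        ... | no outside = ↓ Λ , ↓-club Λ , λ α₀≤α α<Λ → ⊥-elim (outside (α₀≤α , α<Λ))
        ... | yes (α₀≤α , α<Λ) =
          let D , D-club , disjoint = disjoint-club proj₁ λ stationary →
                none (α , α₀≤α , α<Λ , stationary)
          in D , D-club , λ _ _ → disjoint

        D : Ord → Pred Ord ℓ
        D α = proj₁ (D-spec α)
        D-club = λ α → proj₁ (proj₂ (D-spec α))
        D-disjoint = λ α → proj₂ (proj₂ (D-spec α))

        κ-limit : IsLimit κ
        κ-limit = let ω , ((nonempty-ω , _) , _) , ω<κ = κ.uncountable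
                  in noMaximum⇒isLimit (ω , ω<κ) (<cf⇒noMaximum nonempty-ω (isCf⇒<cf κ.regular ω<κ))

        -- A limit `β` closed under this relation lies in the diagonal intersection: each `D α` with
        -- `α < β` is unbounded in `β`.
        Q : Ord → Ord → Set ℓ
        Q ξ η = ∀ α → α < ξ → ∃[ ζ ] ζ < η × ζ ∈ D α × ξ ≤ ζ

        contradict : ∀ {β} → IsClosurePoint Q κ Λ α₀ β →
                     ¬ (∃[ α ] α₀ < α × α < β × (∀ C → C ∈ 𝒞 β → α ∈ acc C))
        contradict {β} point (α , α₀<α , α<β , hits) =
          D-disjoint α (inj₁ α₀<α) (<-trans α<β below) β (below , resize hits)
            (IsClub.closed (D-club α) β below isLimit λ γ γ<β →
              -- Going above `α` as well as `γ` ensures that `D α` is among the clubs treated at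
              -- `ξ`.
              let δ , δ<β , γ≤δ , α≤δ = upper-bound γ<β α<β
                  ξ , δ<ξ , _ , η , η<β , witness = close δ δ<β
                  ζ , ζ<η , ζ∈D , ξ≤ζ = witness α (≤-<-trans α≤δ δ<ξ)
                  ζ<β = <-trans ζ<η η<β
              in ζ , ((ζ∈D , ζ<β) , ζ<β) , inj₁ (<-≤-trans (≤-<-trans γ≤δ δ<ξ) ξ≤ζ))
          where open IsClosurePoint point

theorem2p12 : ∀ {ℓ : Level} → ExcludedMiddle (suc ℓ) → (O : WellOrder ℓ) →
    let open Ordinals O in
    (κ Λ : Ord) → κ < Λ → IsRegularUncountable κ → IsRegularUncountable Λ →
    (∃[ 𝒞 ] IsSquare Λ κ 𝒞 × ¬ IsFull Λ 𝒞) →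
    ∃[ S ] ∃[ T ] IsStationary Λ S × IsStationary Λ T × ¬ ReflectSimultaneously Λ S T
theorem2p12 em O κ Λ κ<Λ κ-regular Λ-regular (𝒞 , (coh , _) , ¬full) =
  let open Classical em O
      α₀ , α₀<Λ , unstable = stable-bound ¬full
      -- Fodor's argument dictates `α`; S α is stationary for every `α` from `α₀` on, so the same
      -- index serves both sets.
      α , α₀≤α , α<Λ , hitting = hitting-stationary coh κ<Λ κ-regular Λ-regular α₀<Λ
  in Avoiding coh α , Hitting coh α ,
     avoiding-stationary coh α<Λ (unstable α α₀≤α) , hitting , not-simultaneous coh
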